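{- The expected value for the number of steps of a grand zigzag knight's path ending at $(n,k)$ is $$\frac{2}{|\mathcal{Z}_{n,k}|}\sum_{\substack{i=0\\ i\text{ even}}}^{n-k}i\binom{i/2}{\frac{n-i-k}{2}}\binom{i/2}{\frac{n-i+k}{2}}\quad\text{if } n\equiv k\pmod 2,$$ and $$\frac{1}{|\mathcal{Z}_{n,k}|}\sum_{\substack{i=0\\ i\text{ odd}}}^{n-k}i\left[\binom{\frac{i+1}{2}}{\frac{n-k-i}{2}+1}\binom{\frac{i-1}{2}}{\frac{n+k-i}{2}-1}+\binom{\frac{i-1}{2}}{\frac{n-k-i}{2}-1}\binom{\frac{i+1}{2}}{\frac{n+k-i}{2}+1}\right]$$ otherwise.
   Context: A grand zigzag knight's path is a lattice path in $\mathbb{Z}^2$ starting at the origin, made of steps $N=(1,2)$, $\bar N=(1,-2)$, $E=(2,1)$, $\bar E=(2,-1)$, such that the vertical components of two consecutive steps are never in the same direction (up-steps $N,E$ and down-steps $\bar N,\bar E$ alternate). $\mathcal{Z}_{n,k}$ is the set of grand zigzag knight's paths whose last point is $(n,k)$, and $|\mathcal{Z}_{n,k}|$ is its cardinality. The expected value is taken over a path chosen uniformly at random in $\mathcal{Z}_{n,k}$ (when this set is nonempty). Conventions: $\binom{a}{b}=0$ if $b<0$ or $b>a\ge0$; a sum with upper limit less than its lower limit is $0$.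
   Formalization: When n and k have different parity and k ≥ 2, the printed upper limit n−k is wrong (for (n,k)=(1,2) the only path is N, with mean 1, but the printed sum is empty); the formal statement uses upper limit n−k+2 there and is otherwise as printed. -}

module Defs where

open import Data.Integer as ℤ using (ℤ; +_; -[1+_]; 0ℤ; 1ℤ; sign; ∣_∣)
import Data.Integer.Properties as ℤ
open import Data.List using
  (List; []; _∷_; length; map; filter; foldr; upTo; cartesianProductWith)
open import Data.List.Membership.Propositional using (_∈_)
open import Data.List.Membership.Propositional.Properties using
  (∈-filter⁺; ∈-filter⁻; ∈-cartesianProductWith⁺; ∈-cartesianProductWith⁻)
open import Data.List.Properties using (∷-injective)
open import Data.List.Relation.Unary.All as All using (All; []; _∷_)
open import Data.List.Relation.Unary.AllPairs using ([]; _∷_)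
open import Data.List.Relation.Unary.Any using (here; there)
open import Data.List.Relation.Unary.Linked using (Linked; linked?)
open import Data.List.Relation.Unary.Unique.Propositional using (Unique)
import Data.List.Relation.Unary.Unique.Propositional.Properties as Unique
open import Data.Nat as ℕ using (ℕ; zero; suc; NonZero; z≤n; s≤s)
open import Data.Nat.Combinatorics using (_C_)
open import Data.Nat.ListAction using (sum)
import Data.Nat.Divisibility as ℕ
open import Data.Product using (_×_; _,_; proj₁; proj₂)
open import Data.Product.Properties using (≡-dec)
open import Data.Rational as ℚ using (ℚ; 0ℚ; _/_)
import Data.Sign.Properties as Sign
open import Relation.Binary.PropositionalEquality using
  (_≡_; _≢_; refl; cong; subst)
open import Relation.Nullary using (¬?; Dec; _×-dec_)

data Step : Set where
  N N̄ E Ē : Step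

vec : Step → ℤ × ℤ
vec N = + 1 , + 2
vec N̄ = + 1 , ℤ.- (+ 2)
vec E = + 2 , + 1
vec Ē = + 2 , ℤ.- (+ 1)

-- A lattice path from the origin is determined by its sequence of steps.
Path : Set
Path = List Step

steps : Path → ℕ
steps = length

lastPoint : Path → ℤ × ℤ
lastPoint []      = 0ℤ , 0ℤ
lastPoint (s ∷ p) = proj₁ (vec s) ℤ.+ proj₁ (lastPoint p)
                  , proj₂ (vec s) ℤ.+ proj₂ (lastPoint p)

-- No vertical component is zero, so comparing signs compares directions.
Alternate : Step → Step → Set
Alternate s t = sign (proj₂ (vec s)) ≢ sign (proj₂ (vec t))

GrandZigzag : Path → Set
GrandZigzag = Linked Alternate

𝒵 : ℤ → ℤ → Path → Set
𝒵 n k p = GrandZigzag p × lastPoint p ≡ (n , k)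

record Enumeration {A : Set} (P : A → Set) : Set where
  field
    elements : List A
    unique   : Unique elements
    sound    : ∀ {a} → a ∈ elements → P a
    complete : ∀ {a} → P a → a ∈ elements

  card : ℕ
  card = length elements

  -- Expectation of X under the uniform distribution on the enumerated set.
  expectation : .{{_ : NonZero card}} → (A → ℕ) → ℚ
  expectation X =
    foldr ℚ._+_ 0ℚ (map (λ a → (+ 1 / card) ℚ.* (+ X a / 1)) elements)

open Enumeration public using (card; expectation)

allSteps : List Step
allSteps = N ∷ N̄ ∷ E ∷ Ē ∷ []

paths≤ : ℕ → List Path
paths≤ zero    = [] ∷ []
paths≤ (suc b) = [] ∷ cartesianProductWith _∷_ allSteps (paths≤ b)

allSteps-unique : Unique allSteps
allSteps-unique =
    ((λ ()) ∷ (λ ()) ∷ (λ ()) ∷ [])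
  ∷ ((λ ()) ∷ (λ ()) ∷ [])
  ∷ ((λ ()) ∷ [])
  ∷ [] ∷ []

allSteps-complete : ∀ s → s ∈ allSteps
allSteps-complete N = here refl
allSteps-complete N̄ = there (here refl)
allSteps-complete E = there (there (here refl))
allSteps-complete Ē = there (there (there (here refl)))

paths≤-unique : ∀ b → Unique (paths≤ b)
paths≤-unique zero    = [] ∷ []
paths≤-unique (suc b) =
    All.tabulate nonempty
  ∷ Unique.cartesianProductWith⁺ _∷_ ∷-injective allSteps-unique (paths≤-unique b)
  where
  nonempty : ∀ {p} → p ∈ cartesianProductWith _∷_ allSteps (paths≤ b) → [] ≢ p
  nonempty p∈ refl with ∈-cartesianProductWith⁻ _∷_ allSteps (paths≤ b) p∈
  ... | _ , _ , _ , _ , ()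

paths≤-complete : ∀ b p → steps p ℕ.≤ b → p ∈ paths≤ b
paths≤-complete zero    []      _         = here refl
paths≤-complete (suc b) []      _         = here refl
paths≤-complete (suc b) (s ∷ p) (s≤s len) =
  there (∈-cartesianProductWith⁺ _∷_ (allSteps-complete s) (paths≤-complete b p len))

1≤Δx : ∀ s → 1ℤ ℤ.≤ proj₁ (vec s)
1≤Δx N = ℤ.+≤+ (s≤s z≤n)
1≤Δx N̄ = ℤ.+≤+ (s≤s z≤n)
1≤Δx E = ℤ.+≤+ (s≤s z≤n)
1≤Δx Ē = ℤ.+≤+ (s≤s z≤n)

steps≤x : ∀ p → + steps p ℤ.≤ proj₁ (lastPoint p)
steps≤x []      = ℤ.≤-refl
steps≤x (s ∷ p) = ℤ.+-mono-≤ (1≤Δx s) (steps≤x p)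

drop‿+≤ : ∀ {m} i → + m ℤ.≤ i → m ℕ.≤ ∣ i ∣
drop‿+≤ (+ _) (ℤ.+≤+ m≤n) = m≤n

alternate? : ∀ s t → Dec (Alternate s t)
alternate? s t = ¬? (sign (proj₂ (vec s)) Sign.≟ sign (proj₂ (vec t)))

𝒵? : ∀ n k p → Dec (𝒵 n k p)
𝒵? n k p = linked? alternate? p ×-dec ≡-dec ℤ._≟_ ℤ._≟_ (lastPoint p) (n , k)

-- Every step advances by at least 1 in x, so a path ending at (n , k)
-- has at most n steps.
𝒵-enumeration : ∀ n k → Enumeration (𝒵 n k)
𝒵-enumeration n k = record
  { elements = filter (𝒵? n k) (paths≤ ∣ n ∣)
  ; unique   = Unique.filter⁺ (𝒵? n k) (paths≤-unique ∣ n ∣)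
  ; sound    = λ p∈ → proj₂ (∈-filter⁻ (𝒵? n k) {xs = paths≤ ∣ n ∣} p∈)
  ; complete = λ {p} z → ∈-filter⁺ (𝒵? n k)
      (paths≤-complete ∣ n ∣ p
        (drop‿+≤ n (subst (+ steps p ℤ.≤_) (cong proj₁ (proj₂ z)) (steps≤x p)))) z
  }

∣𝒵_,_∣ : ℤ → ℤ → ℕ
∣𝒵 n , k ∣ = card (𝒵-enumeration n k)

𝔼-steps : (n k : ℤ) .{{_ : NonZero ∣𝒵 n , k ∣}} → ℚ
𝔼-steps n k = expectation (𝒵-enumeration n k) steps

-- The lower entry may be negative, in which case the coefficient is 0;
-- _C_ is already 0 when the lower entry exceeds the upper one.
binom : ℕ → ℤ → ℕ
binom a (+ b)    = a C b
binom a -[1+ _ ] = 0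

[0⋯_] : ℤ → List ℕ
[0⋯ + m ]      = upTo (suc m)
[0⋯ -[1+ _ ] ] = []

Σ-even : ℤ → (ℕ → ℕ) → ℕ
Σ-even u f = sum (map f (filter (2 ℕ.∣?_) [0⋯ u ]))

Σ-odd : ℤ → (ℕ → ℕ) → ℕ
Σ-odd u f = sum (map f (filter (λ i → ¬? (2 ℕ.∣? i)) [0⋯ u ]))

-- All halvings below are exact for the i over which the terms are summed:
-- evenTerm with i even and n ≡ k (mod 2), oddTerm with i odd and n ≢ k (mod 2).
evenTerm : ℤ → ℤ → ℕ → ℕ
evenTerm n k i =
  i ℕ.* (binom (i ℕ./ 2) ((n ℤ.- + i ℤ.- k) ℤ./ + 2)
    ℕ.* binom (i ℕ./ 2) ((n ℤ.- + i ℤ.+ k) ℤ./ + 2))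

-- Range of the odd i.  For k ≤ 1 every oddTerm with odd i > n - k vanishes.  For
-- k ≥ 2 the term i = n - k + 2 counts the paths that start with an up-step and
-- use N for every up-step, and it can be nonzero: N is the only path to (1 , 2),
-- with 1 step, while a sum up to n - k = -1 is empty.
oddTerm : ℤ → ℤ → ℕ → ℕ
oddTerm n k i =
  i ℕ.* ( binom ((i ℕ.+ 1) ℕ./ 2) ((n ℤ.- k ℤ.- + i) ℤ./ + 2 ℤ.+ + 1)
          ℕ.* binom ((i ℕ.∸ 1) ℕ./ 2) ((n ℤ.+ k ℤ.- + i) ℤ./ + 2 ℤ.- + 1)
        ℕ.+ binom ((i ℕ.∸ 1) ℕ./ 2) ((n ℤ.- k ℤ.- + i) ℤ./ + 2 ℤ.- + 1)
          ℕ.* binom ((i ℕ.+ 1) ℕ./ 2) ((n ℤ.+ k ℤ.- + i) ℤ./ + 2 ℤ.+ + 1))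

{-# OPTIONS --safe #-}

-- Among the zigzag paths with i steps whose first step has a given direction,
-- ⌈i/2⌉ steps have that direction and ⌊i/2⌋ the other one.  If a and b of these
-- are flat (E or Ē) and the rest steep (N or N̄), the path ends at x = i + a + b
-- and y = ± (2 (⌈i/2⌉ - ⌊i/2⌋) + b - a), so i and the endpoint determine a and b,
-- and the number of such paths is binom ⌈i/2⌉ a * binom ⌊i/2⌋ b.  Solving for a
-- and b in both directions gives the terms of the two sums; a, b ≥ 0 bounds i.

module Submission where

open import Defs
open import Data.Integer using (ℤ; +_; _+_; _-_; _≤_; _<_)
open import Data.Integer.Divisibility using (_∣_)
open import Data.Nat using (NonZero)
open import Data.Product using (_×_)
open import Data.Rational using (_/_; _*_)
open import Relation.Binary.PropositionalEquality using (_≡_)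
open import Relation.Nullary using (¬_)

import Algebra.Properties.AbelianGroup as AbelianGroupProperties
open import Data.Bool using (true; false)
open import Data.Integer as ℤ using (-[1+_]; 0ℤ; 1ℤ; sign; +≤+)
import Data.Integer.Divisibility.Signed as Signed
import Data.Integer.DivMod as ℤ
import Data.Integer.Properties as ℤ
open import Data.Integer.Tactic.RingSolver using (solve-∀)
open import Data.List using (List; []; _∷_; _++_; concatMap; filter; foldr; length; map)
open import Data.List.Membership.Propositional using (_∈_; find; lose)
open import Data.List.Membership.Propositional.Properties using
  (∈-++⁺ˡ; ∈-++⁺ʳ; ∈-++⁻; ∈-map⁺; ∈-map⁻; ∈-filter⁺; ∈-filter⁻; ∈-concatMap⁺; ∈-concatMap⁻; ∈-upTo⁺)
open import Data.List.Membership.Propositional.Properties.WithK using (unique∧set⇒bag)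
import Data.List.Properties as List
open import Data.List.Relation.Binary.BagAndSetEquality using (∼bag⇒↭)
import Data.List.Relation.Binary.Permutation.Propositional.Properties as Perm
open import Data.List.Relation.Unary.All as All using ([]; _∷_)
import Data.List.Relation.Unary.All.Properties as All
open import Data.List.Relation.Unary.AllPairs as AllPairs using ([]; _∷_)
import Data.List.Relation.Unary.AllPairs.Properties as AllPairs
open import Data.List.Relation.Unary.Any using (here; there)
open import Data.List.Relation.Unary.Linked using ([]; [-]; _∷_)
open import Data.List.Relation.Unary.Unique.Propositional using (Unique)
import Data.List.Relation.Unary.Unique.Propositional.Properties as Unique
open import Data.Nat as ℕ using (ℕ; zero; suc; ⌊_/2⌋; ⌈_/2⌉; z≤n; s≤s)
open import Data.Nat.Combinatorics using (_C_; nCk+nC[k+1]≡[n+1]C[k+1]; k>n⇒nCk≡0)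
import Data.Nat.Divisibility as ℕ
import Data.Nat.DivMod as ℕ
open import Data.Nat.ListAction using (sum)
open import Data.Nat.ListAction.Properties using (sum-++; sum-↭)
import Data.Nat.Properties as ℕ
import Data.Nat.Tactic.RingSolver as ℕSolver
open import Data.Product using (_,_; proj₁; proj₂; ∃₂; ∃-syntax)
open import Data.Product.Properties using (≡-dec)
open import Data.Rational as ℚ using (ℚ; 0ℚ; toℚᵘ)
import Data.Rational.Properties as ℚ
import Data.Rational.Unnormalised as ℚᵘ
import Data.Rational.Unnormalised.Properties as ℚᵘ
open import Data.Sign as Sign using (Sign; opposite)
open import Data.Sum using (_⊎_; inj₁; inj₂; [_,_]′)
open import Function using (_∘_; case_of_; mk⇔)
open import Level using (0ℓ)
open import Relation.Binary.PropositionalEquality using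
  (_≢_; refl; sym; trans; cong; cong₂; subst; module ≡-Reasoning)
open import Relation.Nullary using (Dec; yes; no; ¬?; contradiction)
open import Relation.Unary using (Pred; Decidable)

-- Alternating words listed by length and direction of the first step

steep flat : Sign → Step
steep Sign.+ = N
steep Sign.- = N̄
flat Sign.+ = E
flat Sign.- = Ē

direction : Step → Sign
direction = sign ∘ proj₂ ∘ vec

words : Sign → ℕ → List Path
words σ zero    = [] ∷ []
words σ (suc i) = map (steep σ ∷_) (words (opposite σ) i)
               ++ map (flat σ ∷_) (words (opposite σ) i)

-- Length 0 is separate because both directions give the same empty path, which must be listed only
-- once.
zigzags : ℕ → List Path
zigzags zero      = [] ∷ []
zigzags i@(suc _) = words Sign.+ i ++ words Sign.- i

≢⇒opposite : ∀ {σ τ} → σ ≢ τ → τ ≡ opposite σ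
≢⇒opposite {Sign.-} {Sign.-} σ≢τ = contradiction refl σ≢τ
≢⇒opposite {Sign.-} {Sign.+} σ≢τ = refl
≢⇒opposite {Sign.+} {Sign.-} σ≢τ = refl
≢⇒opposite {Sign.+} {Sign.+} σ≢τ = contradiction refl σ≢τ

direction-steep : ∀ σ → direction (steep σ) ≡ σ
direction-steep Sign.- = refl
direction-steep Sign.+ = refl

direction-flat : ∀ σ → direction (flat σ) ≡ σ
direction-flat Sign.- = refl
direction-flat Sign.+ = refl

≢-opposite : ∀ {σ} → σ ≢ opposite σ
≢-opposite {Sign.-} ()
≢-opposite {Sign.+} ()

words⁻ : ∀ σ i {p} → p ∈ words σ (suc i) →
  ∃₂ λ s q → direction s ≡ σ × q ∈ words (opposite σ) i × p ≡ s ∷ q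
words⁻ σ i p∈ with ∈-++⁻ (map (steep σ ∷_) (words (opposite σ) i)) p∈
... | inj₁ p∈ˡ = let q , q∈ , eq = ∈-map⁻ (steep σ ∷_) p∈ˡ
                 in steep σ , q , direction-steep σ , q∈ , eq
... | inj₂ p∈ʳ = let q , q∈ , eq = ∈-map⁻ (flat σ ∷_) p∈ʳ
                 in flat σ , q , direction-flat σ , q∈ , eq

-- Indexed by the step rather than by a sign: once `s` is split, its direction computes and selects
-- the half of the list to which `s ∷ q` belongs.
words⁺ : ∀ s i {q} → q ∈ words (opposite (direction s)) i → s ∷ q ∈ words (direction s) (suc i)
words⁺ N i q∈ = ∈-++⁺ˡ (∈-map⁺ _ q∈)
words⁺ N̄ i q∈ = ∈-++⁺ˡ (∈-map⁺ _ q∈)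
words⁺ E i q∈ = ∈-++⁺ʳ (map (N ∷_) (words Sign.- i)) (∈-map⁺ _ q∈)
words⁺ Ē i q∈ = ∈-++⁺ʳ (map (N̄ ∷_) (words Sign.+ i)) (∈-map⁺ _ q∈)

words-length : ∀ σ i {p} → p ∈ words σ i → length p ≡ i
words-length σ zero    (here refl) = refl
words-length σ (suc i) p∈ with words⁻ σ i p∈
... | s , q , _ , q∈ , refl = cong suc (words-length (opposite σ) i q∈)

words-sound : ∀ σ i {p} → p ∈ words σ i → GrandZigzag p
words-sound σ zero    (here refl) = []
words-sound σ (suc i) p∈ with words⁻ σ i p∈
words-sound σ (suc zero)    _ | s , .[] , _ , here refl , refl = [-]
words-sound σ (suc (suc i)) _ | s , q , s≡σ , q∈ , refl
  with words⁻ (opposite σ) i q∈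
... | t , r , t≡-σ , r∈ , refl =
  (λ s≡t → ≢-opposite (trans (sym s≡σ) (trans s≡t t≡-σ))) ∷ words-sound (opposite σ) (suc i) q∈

words-complete : ∀ s p → GrandZigzag (s ∷ p) → s ∷ p ∈ words (direction s) (length (s ∷ p))
words-complete s []      _         = words⁺ s zero (here refl)
words-complete s (t ∷ p) (s≢t ∷ z) =
  words⁺ s (suc (length p))
    (subst (λ σ → t ∷ p ∈ words σ (suc (length p))) (≢⇒opposite s≢t) (words-complete t p z))

words-unique : ∀ σ i → Unique (words σ i)
words-unique σ zero    = [] ∷ []
words-unique σ (suc i) =
  Unique.++⁺ (Unique.map⁺ List.∷-injectiveʳ tails!) (Unique.map⁺ List.∷-injectiveʳ tails!)
    λ (p∈ˡ , p∈ʳ) → steep≢flat σ (disjoint (∈-map⁻ _ p∈ˡ) (∈-map⁻ _ p∈ʳ))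
  where
  tails! = words-unique (opposite σ) i
  steep≢flat : ∀ τ → steep τ ≢ flat τ
  steep≢flat Sign.- ()
  steep≢flat Sign.+ ()
  disjoint : ∀ {s t p} {ps qs : List Path} →
    (∃₂ λ q (_ : q ∈ ps) → p ≡ s ∷ q) → (∃₂ λ q (_ : q ∈ qs) → p ≡ t ∷ q) → s ≡ t
  disjoint (_ , _ , refl) (_ , _ , eq) = List.∷-injectiveˡ eq

zigzags-cases : ∀ i {p} → p ∈ zigzags i → p ∈ words Sign.+ i ⊎ p ∈ words Sign.- i
zigzags-cases zero    p∈ = inj₁ p∈
zigzags-cases (suc i) p∈ = ∈-++⁻ (words Sign.+ (suc i)) p∈

zigzags-length : ∀ i {p} → p ∈ zigzags i → length p ≡ i
zigzags-length i = [ words-length Sign.+ i , words-length Sign.- i ]′ ∘ zigzags-cases i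

zigzags-sound : ∀ i {p} → p ∈ zigzags i → GrandZigzag p
zigzags-sound i = [ words-sound Sign.+ i , words-sound Sign.- i ]′ ∘ zigzags-cases i

zigzags-complete : ∀ p → GrandZigzag p → p ∈ zigzags (length p)
zigzags-complete []          _ = here refl
zigzags-complete p@(s ∷ q) z = case-direction (direction s) (words-complete s q z)
  where
  -- Replacing `direction s` by a variable allows the split on the sign to refine the type of the
  -- membership.
  case-direction : ∀ σ → p ∈ words σ (length p) → p ∈ zigzags (length p)
  case-direction Sign.+ = ∈-++⁺ˡ
  case-direction Sign.- = ∈-++⁺ʳ (words Sign.+ (length p))

zigzags-unique : ∀ i → Unique (zigzags i)
zigzags-unique zero    = [] ∷ []
zigzags-unique (suc i) =
  Unique.++⁺ (words-unique Sign.+ (suc i)) (words-unique Sign.- (suc i))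
    λ (p∈⁺ , p∈⁻) → disjoint (words⁻ Sign.+ i p∈⁺) (words⁻ Sign.- i p∈⁻)
  where
  disjoint : ∀ {p} {P Q : Path → Set} →
    (∃₂ λ s q → direction s ≡ Sign.+ × P q × p ≡ s ∷ q) →
    ¬ (∃₂ λ s q → direction s ≡ Sign.- × Q q × p ≡ s ∷ q)
  disjoint (_ , _ , s≡+ , _ , refl) (_ , _ , s≡- , _ , refl) = case trans (sym s≡+) s≡- of λ ()

-- Endpoints in terms of the numbers of flat steps

infixr 6 _⊕_
_⊕_ : ℤ × ℤ → ℤ × ℤ → ℤ × ℤ
(x , y) ⊕ (x′ , y′) = x + x′ , y + y′

⊕-cancelˡ : ∀ u {v w} → u ⊕ v ≡ u ⊕ w → v ≡ w
⊕-cancelˡ (x , y) eq =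
  cong₂ _,_ (ℤ+.∙-cancelˡ x _ _ (cong proj₁ eq)) (ℤ+.∙-cancelˡ y _ _ (cong proj₂ eq))
  where module ℤ+ = AbelianGroupProperties ℤ.+-0-abelianGroup

endsAt? : ∀ v p → Dec (lastPoint p ≡ v)
endsAt? v p = ≡-dec ℤ._≟_ ℤ._≟_ (lastPoint p) v

ending : ℤ × ℤ → List Path → List Path
ending v = filter (endsAt? v)

signed : Sign → ℤ → ℤ
signed Sign.+ z = z
signed Sign.- z = ℤ.- z

-- Surplus of steps in the direction of the first one: 0 for even `i`, 1 for odd `i`. As a
-- difference of halves it unfolds from `suc i` to `i` without a parity split.
gap : ℕ → ℤ
gap i = + ⌈ i /2⌉ - + ⌊ i /2⌋

-- a counts the flat steps in the direction σ of the first step, b those in the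
-- opposite direction, so removing the first step swaps the two roles.
endpoint : Sign → ℕ → ℤ → ℤ → ℤ × ℤ
endpoint σ i a b =
  + i + a + b , signed σ (+ 2 ℤ.* gap i + (b - a))

endpoint-steep : ∀ σ i a b →
  endpoint σ (suc i) a b ≡ vec (steep σ) ⊕ endpoint (opposite σ) i b a
-- By definition `⌈ suc i /2⌉` is `suc ⌊ i /2⌋` and `⌊ suc i /2⌋` is `⌈ i /2⌉`, so after
-- generalising the two halves to `c` and `f` only ring identities remain.
endpoint-steep σ i a b = go σ (+ i) (+ ⌈ i /2⌉) (+ ⌊ i /2⌋) a b
  where
  x≡ : ∀ i a b → 1ℤ + i + a + b ≡ + 1 + (i + b + a)
  x≡ = solve-∀
  y⁺ : ∀ c f a b → + 2 ℤ.* (1ℤ + f - c) + (b - a)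
    ≡ + 2 + ℤ.- (+ 2 ℤ.* (c - f) + (a - b))
  y⁺ = solve-∀
  y⁻ : ∀ c f a b → ℤ.- (+ 2 ℤ.* (1ℤ + f - c) + (b - a))
    ≡ ℤ.- (+ 2) + (+ 2 ℤ.* (c - f) + (a - b))
  y⁻ = solve-∀
  go : ∀ σ i c f a b →
    (1ℤ + i + a + b , signed σ (+ 2 ℤ.* (1ℤ + f - c) + (b - a)))
    ≡ vec (steep σ) ⊕ (i + b + a , signed (opposite σ) (+ 2 ℤ.* (c - f) + (a - b)))
  go Sign.+ i c f a b = cong₂ _,_ (x≡ i a b) (y⁺ c f a b)
  go Sign.- i c f a b = cong₂ _,_ (x≡ i a b) (y⁻ c f a b)

endpoint-flat : ∀ σ i a b →
  endpoint σ (suc i) (ℤ.suc a) b ≡ vec (flat σ) ⊕ endpoint (opposite σ) i b a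
endpoint-flat σ i a b = go σ (+ i) (+ ⌈ i /2⌉) (+ ⌊ i /2⌋) a b
  where
  x≡ : ∀ i a b → 1ℤ + i + (1ℤ + a) + b ≡ + 2 + (i + b + a)
  x≡ = solve-∀
  y⁺ : ∀ c f a b → + 2 ℤ.* (1ℤ + f - c) + (b - (1ℤ + a))
    ≡ + 1 + ℤ.- (+ 2 ℤ.* (c - f) + (a - b))
  y⁺ = solve-∀
  y⁻ : ∀ c f a b → ℤ.- (+ 2 ℤ.* (1ℤ + f - c) + (b - (1ℤ + a)))
    ≡ ℤ.- (+ 1) + (+ 2 ℤ.* (c - f) + (a - b))
  y⁻ = solve-∀
  go : ∀ σ i c f a b →
    (1ℤ + i + (1ℤ + a) + b , signed σ (+ 2 ℤ.* (1ℤ + f - c) + (b - (1ℤ + a))))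
    ≡ vec (flat σ) ⊕ (i + b + a , signed (opposite σ) (+ 2 ℤ.* (c - f) + (a - b)))
  go Sign.+ i c f a b = cong₂ _,_ (x≡ i a b) (y⁺ c f a b)
  go Sign.- i c f a b = cong₂ _,_ (x≡ i a b) (y⁻ c f a b)

words-endpoint : ∀ σ i {p} → p ∈ words σ i → ∃₂ λ a b → lastPoint p ≡ endpoint σ i (+ a) (+ b)
words-endpoint Sign.- zero (here refl) = 0 , 0 , refl
words-endpoint Sign.+ zero (here refl) = 0 , 0 , refl
words-endpoint σ (suc i) p∈ with ∈-++⁻ (map (steep σ ∷_) (words (opposite σ) i)) p∈
... | inj₁ p∈ˡ with ∈-map⁻ (steep σ ∷_) p∈ˡ
...   | q , q∈ , refl = let b , a , eq = words-endpoint (opposite σ) i q∈ in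
  a , b , trans (cong (vec (steep σ) ⊕_) eq) (sym (endpoint-steep σ i (+ a) (+ b)))
words-endpoint σ (suc i) p∈ | inj₂ p∈ʳ with ∈-map⁻ (flat σ ∷_) p∈ʳ
...   | q , q∈ , refl = let b , a , eq = words-endpoint (opposite σ) i q∈ in
  suc a , b , trans (cong (vec (flat σ) ⊕_) eq) (sym (endpoint-flat σ i (+ a) (+ b)))

-- Counting the words with a given endpoint

filter-map : ∀ {A B : Set} {P : Pred B 0ℓ} (P? : Decidable P) (f : A → B) xs →
  filter P? (map f xs) ≡ map f (filter (P? ∘ f) xs)
filter-map P? f [] = refl
filter-map P? f (x ∷ xs) with Dec.does (P? (f x))
... | true  = cong (f x ∷_) (filter-map P? f xs)
... | false = filter-map P? f xs

-- Translation by `vec s` is injective, so `s ∷ p` ends at `vec s ⊕ v` exactly when `p` ends at `v`.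
∣ending∣-∷ : ∀ s v ps → length (ending (vec s ⊕ v) (map (s ∷_) ps)) ≡ length (ending v ps)
∣ending∣-∷ s v ps = begin
  length (ending (vec s ⊕ v) (map (s ∷_) ps))
    ≡⟨ cong length (filter-map (endsAt? (vec s ⊕ v)) (s ∷_) ps) ⟩
  length (map (s ∷_) (filter (endsAt? (vec s ⊕ v) ∘ (s ∷_)) ps))
    ≡⟨ List.length-map (s ∷_) (filter (endsAt? (vec s ⊕ v) ∘ (s ∷_)) ps) ⟩
  length (filter (endsAt? (vec s ⊕ v) ∘ (s ∷_)) ps)
    ≡⟨ cong length (List.filter-≐ (endsAt? (vec s ⊕ v) ∘ (s ∷_)) (endsAt? v)
         (⊕-cancelˡ (vec s) , cong (vec s ⊕_)) ps) ⟩
  length (ending v ps) ∎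
  where open ≡-Reasoning

∣ending∣-++ : ∀ v ps qs → length (ending v (ps ++ qs)) ≡ length (ending v ps) ℕ.+ length (ending v qs)
∣ending∣-++ v ps qs =
  trans (cong length (List.filter-++ (endsAt? v) ps qs)) (List.length-++ (ending v ps))

-- Pascal's rule for every integer lower entry: at -1 it reads 1 = 1 + 0, and below that 0 = 0 + 0.
binom-suc : ∀ m a → binom (suc m) (ℤ.suc a) ≡ binom m (ℤ.suc a) ℕ.+ binom m a
binom-suc m (+ a)        =
  trans (sym (nCk+nC[k+1]≡[n+1]C[k+1] m a)) (ℕ.+-comm (m C a) (m C suc a))
binom-suc m -[1+ zero ]  = refl
binom-suc m -[1+ suc a ] = refl

binom-0 : ∀ {a} → a ≢ + 0 → binom 0 a ≡ 0
binom-0 {+ zero}    a≢0 = contradiction refl a≢0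
binom-0 {+ (suc a)} a≢0 = k>n⇒nCk≡0 (ℕ.0<1+n {a})
binom-0 { -[1+ a ]} a≢0 = refl

-- With no steps, a + b and b - a both vanish, hence so do 2a and 2b. Since `a` and `b` may be
-- negative, a + b = 0 alone would not suffice.
endpoint-origin : ∀ σ a b → (+ 0 , + 0) ≡ endpoint σ 0 a b → a ≡ + 0 × b ≡ + 0
endpoint-origin σ a b eq = ℤ.*-cancelˡ-≡ (+ 2) a (+ 0) 2a≡0 , ℤ.*-cancelˡ-≡ (+ 2) b (+ 0) 2b≡0
  where
  sum≡0 : + 0 + a + b ≡ + 0
  sum≡0 = cong proj₁ (sym eq)
  signed≡0 : ∀ σ z → + 0 ≡ signed σ z → z ≡ + 0
  signed≡0 Sign.+ z eq = sym eq
  signed≡0 Sign.- z eq = ℤ.neg-injective (sym eq)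
  difference≡0 : + 0 + (b - a) ≡ + 0
  difference≡0 = signed≡0 σ (+ 0 + (b - a)) (cong proj₂ eq)
  2a : ∀ a b → + 2 ℤ.* a ≡ (+ 0 + a + b) - (+ 0 + (b - a))
  2a = solve-∀
  2b : ∀ a b → + 2 ℤ.* b ≡ (+ 0 + a + b) + (+ 0 + (b - a))
  2b = solve-∀
  2a≡0 : + 2 ℤ.* a ≡ + 0
  2a≡0 = trans (2a a b) (cong₂ _-_ sum≡0 difference≡0)
  2b≡0 : + 2 ℤ.* b ≡ + 0
  2b≡0 = trans (2b a b) (cong₂ _+_ sum≡0 difference≡0)

-- Induction on the first step: a steep one leaves the parameters (b, a), a flat one (b, a - 1),
-- both for the opposite direction. The factor for `b` is common, and Pascal's rule merges the
-- factors for a and a - 1. Integer parameters let a - 1 drop below 0, where the count is 0, without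
-- a separate case.
words-count : ∀ σ i a b →
  length (ending (endpoint σ i a b) (words σ i)) ≡ binom ⌈ i /2⌉ a ℕ.* binom ⌊ i /2⌋ b
words-count σ zero a b with a ℤ.≟ + 0 | b ℤ.≟ + 0
-- The sign is split only to make `endpoint` compute to the origin.
words-count Sign.- zero _ _ | yes refl | yes refl = refl
words-count Sign.+ zero _ _ | yes refl | yes refl = refl
words-count σ zero a b | no a≢0 | _ = begin
  length (ending (endpoint σ zero a b) ([] ∷ []))
    ≡⟨ cong length (List.filter-none (endsAt? (endpoint σ zero a b)) {xs = [] ∷ []}
         ((a≢0 ∘ proj₁ ∘ endpoint-origin σ a b) ∷ [])) ⟩
  0
    ≡⟨ cong (ℕ._* binom 0 b) (binom-0 a≢0) ⟨
  binom 0 a ℕ.* binom 0 b ∎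
  where open ≡-Reasoning
words-count σ zero a b | yes _ | no b≢0 = begin
  length (ending (endpoint σ zero a b) ([] ∷ []))
    ≡⟨ cong length (List.filter-none (endsAt? (endpoint σ zero a b)) {xs = [] ∷ []}
         ((b≢0 ∘ proj₂ ∘ endpoint-origin σ a b) ∷ [])) ⟩
  0
    ≡⟨ ℕ.*-zeroʳ (binom 0 a) ⟨
  binom 0 a ℕ.* 0
    ≡⟨ cong (binom 0 a ℕ.*_) (binom-0 b≢0) ⟨
  binom 0 a ℕ.* binom 0 b ∎
  where open ≡-Reasoning
words-count σ (suc i) a b = begin
  length (ending v (words σ (suc i)))
    ≡⟨ ∣ending∣-++ v (map (steep σ ∷_) ws) (map (flat σ ∷_) ws) ⟩
  length (ending v (map (steep σ ∷_) ws)) ℕ.+ length (ending v (map (flat σ ∷_) ws))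
    ≡⟨ cong₂ ℕ._+_ (by-step (steep σ) (endpoint-steep σ i a b)) (by-step (flat σ) v≡) ⟩
  length (ending (endpoint (opposite σ) i b a) ws)
    ℕ.+ length (ending (endpoint (opposite σ) i b (ℤ.pred a)) ws)
    ≡⟨ cong₂ ℕ._+_ (words-count (opposite σ) i b a) (words-count (opposite σ) i b (ℤ.pred a)) ⟩
  B ℕ.* binom ⌊ i /2⌋ a ℕ.+ B ℕ.* binom ⌊ i /2⌋ (ℤ.pred a)
    ≡⟨ ℕ.*-distribˡ-+ B (binom ⌊ i /2⌋ a) (binom ⌊ i /2⌋ (ℤ.pred a)) ⟨
  B ℕ.* (binom ⌊ i /2⌋ a ℕ.+ binom ⌊ i /2⌋ (ℤ.pred a))
    -- Only the first lower entry is rewritten, giving the shape of Pascal's rule at `ℤ.pred a`.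
    ≡⟨ cong (λ a′ → B ℕ.* (binom ⌊ i /2⌋ a′ ℕ.+ binom ⌊ i /2⌋ (ℤ.pred a))) (ℤ.suc-pred a) ⟨
  B ℕ.* (binom ⌊ i /2⌋ (ℤ.suc (ℤ.pred a)) ℕ.+ binom ⌊ i /2⌋ (ℤ.pred a))
    ≡⟨ cong (B ℕ.*_) (binom-suc ⌊ i /2⌋ (ℤ.pred a)) ⟨
  B ℕ.* binom (suc ⌊ i /2⌋) (ℤ.suc (ℤ.pred a))
    ≡⟨ cong (λ a′ → B ℕ.* binom (suc ⌊ i /2⌋) a′) (ℤ.suc-pred a) ⟩
  B ℕ.* binom (suc ⌊ i /2⌋) a
    ≡⟨ ℕ.*-comm B _ ⟩
  binom (suc ⌊ i /2⌋) a ℕ.* B ∎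
  where
  open ≡-Reasoning
  B  = binom ⌈ i /2⌉ b
  v  = endpoint σ (suc i) a b
  ws = words (opposite σ) i
  v≡ : v ≡ vec (flat σ) ⊕ endpoint (opposite σ) i b (ℤ.pred a)
  v≡ = trans (cong (λ a′ → endpoint σ (suc i) a′ b) (sym (ℤ.suc-pred a)))
             (endpoint-flat σ i (ℤ.pred a) b)
  by-step : ∀ s {w} → v ≡ vec s ⊕ w →
    length (ending v (map (s ∷_) ws)) ≡ length (ending w ws)
  by-step s {w} v≡ = trans (cong (λ v → length (ending v (map (s ∷_) ws))) v≡) (∣ending∣-∷ s w ws)

-- Sums over lists and splitting the total by length

sum-map-const : ∀ {A : Set} (f : A → ℕ) c xs → (∀ {x} → x ∈ xs → f x ≡ c) →
  sum (map f xs) ≡ c ℕ.* length xs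
sum-map-const f c []       _   = sym (ℕ.*-zeroʳ c)
sum-map-const f c (x ∷ xs) f≡c =
  trans (cong₂ ℕ._+_ (f≡c (here refl)) (sum-map-const f c xs (f≡c ∘ there)))
        (sym (ℕ.*-suc c (length xs)))

sum-map-concatMap : ∀ {A B : Set} (f : B → ℕ) (g : A → List B) xs →
  sum (map f (concatMap g xs)) ≡ sum (map (λ x → sum (map f (g x))) xs)
sum-map-concatMap f g []       = refl
sum-map-concatMap f g (x ∷ xs) = begin
  sum (map f (g x ++ concatMap g xs))
    ≡⟨ cong sum (List.map-++ f (g x) (concatMap g xs)) ⟩
  sum (map f (g x) ++ map f (concatMap g xs))
    ≡⟨ sum-++ (map f (g x)) (map f (concatMap g xs)) ⟩
  sum (map f (g x)) ℕ.+ sum (map f (concatMap g xs))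
    ≡⟨ cong (sum (map f (g x)) ℕ.+_) (sum-map-concatMap f g xs) ⟩
  sum (map f (g x)) ℕ.+ sum (map (λ x → sum (map f (g x))) xs) ∎
  where open ≡-Reasoning

sum-map-cong-∈ : ∀ {A : Set} {f g : A → ℕ} xs → (∀ {x} → x ∈ xs → f x ≡ g x) →
  sum (map f xs) ≡ sum (map g xs)
sum-map-cong-∈ xs f≡g = cong sum (List.map-cong-local (All.tabulate f≡g))

sum-map-* : ∀ {A : Set} c (f : A → ℕ) xs → sum (map (λ x → c ℕ.* f x) xs) ≡ c ℕ.* sum (map f xs)
sum-map-* c f []       = sym (ℕ.*-zeroʳ c)
sum-map-* c f (x ∷ xs) =
  trans (cong (c ℕ.* f x ℕ.+_) (sum-map-* c f xs)) (sym (ℕ.*-distribˡ-+ c (f x) _))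

-- Splits the paths by length; the index list need only contain the lengths that occur.
sum-steps : ∀ {n k} (e : Enumeration (𝒵 n k)) is → Unique is →
  (∀ {p} → 𝒵 n k p → length p ∈ is) →
  sum (map steps (Enumeration.elements e))
    ≡ sum (map (λ i → i ℕ.* length (ending (n , k) (zigzags i))) is)
sum-steps {n} {k} e is is! covers = begin
  sum (map steps elements)
    -- Two lists without repetitions and with the same members are permutations of each other, so
    -- their sums agree.
    ≡⟨ sum-↭ (Perm.map⁺ steps (∼bag⇒↭ (unique∧set⇒bag unique byLength! (mk⇔ to from)))) ⟩
  sum (map steps byLength)
    ≡⟨ sum-map-concatMap steps layer is ⟩
  sum (map (λ i → sum (map steps (layer i))) is)
    ≡⟨ sum-map-cong-∈ is (λ {i} _ → sum-map-const steps i (layer i) (zigzags-length i ∘ layer⊆ i)) ⟩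
  sum (map (λ i → i ℕ.* length (layer i)) is) ∎
  where
  open ≡-Reasoning
  open Enumeration e
  layer : ℕ → List Path
  layer = ending (n , k) ∘ zigzags
  layer⊆ : ∀ i {p} → p ∈ layer i → p ∈ zigzags i
  layer⊆ i = proj₁ ∘ ∈-filter⁻ (endsAt? (n , k)) {xs = zigzags i}
  byLength : List Path
  byLength = concatMap layer is
  byLength! : Unique byLength
  byLength! = Unique.concat⁺
    (All.map⁺ (All.tabulate λ {i} _ → Unique.filter⁺ (endsAt? (n , k)) (zigzags-unique i)))
    (AllPairs.map⁺ (AllPairs.map disjoint is!))
    where
    disjoint : ∀ {i j} → i ≢ j → ∀ {p} → ¬ (p ∈ layer i × p ∈ layer j)
    disjoint {i} {j} i≢j (p∈i , p∈j) =
      i≢j (trans (sym (zigzags-length i (layer⊆ i p∈i))) (zigzags-length j (layer⊆ j p∈j)))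
  to : ∀ {p} → p ∈ elements → p ∈ byLength
  to {p} p∈ = let z , end = sound p∈ in
    ∈-concatMap⁺ layer (lose (covers (z , end)) (∈-filter⁺ (endsAt? (n , k)) (zigzags-complete p z) end))
  from : ∀ {p} → p ∈ byLength → p ∈ elements
  from p∈ with find (∈-concatMap⁻ layer {xs = is} p∈)
  ... | i , _ , p∈i with ∈-filter⁻ (endsAt? (n , k)) {xs = zigzags i} p∈i
  ... | p∈zz , end = complete (zigzags-sound i p∈zz , end)

-- Halving and parity

⌊m*2/2⌋ : ∀ m → ⌊ m ℕ.* 2 /2⌋ ≡ m
⌊m*2/2⌋ zero    = refl
⌊m*2/2⌋ (suc m) = cong suc (⌊m*2/2⌋ m)

⌈m*2/2⌉ : ∀ m → ⌈ m ℕ.* 2 /2⌉ ≡ m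
⌈m*2/2⌉ zero    = refl
⌈m*2/2⌉ (suc m) = cong suc (⌈m*2/2⌉ m)

-- The floor quotient x satisfies 2x ≤ 2q < 2(x + 1), which forces x ≤ q < x + 1.
q*2/2≡q : ∀ {z} q → z ≡ q ℤ.* + 2 → z ℤ./ + 2 ≡ q
q*2/2≡q q refl = ℤ.≤-antisym
  (ℤ.*-cancelʳ-≤-pos x q (+ 2) (ℤ.[n/d]*d≤n z (+ 2)))
  (subst (q ≤_) (ℤ.pred-suc x) (ℤ.i<j⇒i≤pred[j] (ℤ.*-cancelʳ-<-nonNeg {q} {ℤ.suc x} (+ 2) q<suc)))
  where
  z = q ℤ.* + 2
  x = z ℤ./ + 2
  q<suc : z < ℤ.suc x ℤ.* + 2
  q<suc = subst (λ y → z < ℤ.suc y ℤ.* + 2) (sym (ℤ.div-pos-is-/ℕ z 2)) (ℤ.n<s[n/ℕd]*d z 2)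

odd⇒1+q*2 : ∀ z → ¬ (+ 2 ∣ z) → ∃[ q ] z ≡ 1ℤ + q ℤ.* + 2
odd⇒1+q*2 z 2∤z with z ℤ.% + 2 | ℤ.n%d<d z (+ 2) | ℤ.a≡a%n+[a/n]*n z (+ 2)
... | 0 | _ | eq = contradiction
  (Signed.∣⇒∣ᵤ (Signed.divides (z ℤ./ + 2) (trans eq (ℤ.+-identityˡ _)))) 2∤z
... | 1 | _ | eq = z ℤ./ + 2 , eq
... | suc (suc r) | s≤s (s≤s ()) | _

oddℕ⇒1+m*2 : ∀ i → ¬ (2 ℕ.∣ i) → ∃[ m ] i ≡ suc (m ℕ.* 2)
oddℕ⇒1+m*2 i 2∤i with i ℕ.% 2 | ℕ.m%n<n i 2 | ℕ.m≡m%n+[m/n]*n i 2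
... | 0 | _ | eq = contradiction (ℕ.divides (i ℕ./ 2) eq) 2∤i
... | 1 | _ | eq = i ℕ./ 2 , eq
... | suc (suc r) | s≤s (s≤s ()) | _

even-gap : ∀ {i} → 2 ℕ.∣ i → gap i ≡ 0ℤ
even-gap (ℕ.divides m refl) rewrite ⌈m*2/2⌉ m | ⌊m*2/2⌋ m = ℤ.+-inverseʳ (+ m)

odd-gap : ∀ {i} → ¬ (2 ℕ.∣ i) → gap i ≡ 1ℤ
odd-gap {i} 2∤i with oddℕ⇒1+m*2 i 2∤i
... | m , refl rewrite ⌈m*2/2⌉ m | ⌊m*2/2⌋ m = 1+z-z (+ m)
  where
  1+z-z : ∀ z → 1ℤ + z - z ≡ 1ℤ
  1+z-z = solve-∀

-- Identifying the counts with the terms of the two sums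

words-count-at : ∀ σ i a b {x y g} → gap i ≡ g →
  x ≡ + i + a + b → y ≡ signed σ (+ 2 ℤ.* g + (b - a)) →
  length (ending (x , y) (words σ i)) ≡ binom ⌈ i /2⌉ a ℕ.* binom ⌊ i /2⌋ b
words-count-at σ i a b refl refl refl = words-count σ i a b

-- For i = 2m each direction has m steps. Starting upwards, `a` up-steps and `b` down-steps are
-- flat; starting downwards only exchanges the two factors. The equal counts give the factor 2.
evenTerm-count : ∀ n k i → + 2 ∣ n - k → 2 ℕ.∣ i →
  i ℕ.* length (ending (n , k) (zigzags i)) ≡ 2 ℕ.* evenTerm n k i
-- The empty path has no starting direction and is not counted twice; the weight i = 0 hides this.
evenTerm-count n k zero _ _ = refl
evenTerm-count n k i@(suc _) 2∣n-k 2∣i@(ℕ.divides m i≡m*2) = begin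
  i ℕ.* length (ending (n , k) (words Sign.+ i ++ words Sign.- i))
    ≡⟨ cong (i ℕ.*_) (∣ending∣-++ (n , k) (words Sign.+ i) (words Sign.- i)) ⟩
  i ℕ.* (length (ending (n , k) (words Sign.+ i)) ℕ.+ length (ending (n , k) (words Sign.- i)))
    ≡⟨ cong (i ℕ.*_) (cong₂ ℕ._+_ count⁺ count⁻) ⟩
  i ℕ.* (A ℕ.* B ℕ.+ B ℕ.* A)
    ≡⟨ double i A B ⟩
  2 ℕ.* (i ℕ.* (A ℕ.* B))
    ≡⟨ cong (λ c → 2 ℕ.* (i ℕ.* c)) (cong₂ ℕ._*_
         (cong₂ binom i/2≡m (q*2/2≡q a x-i-y≡a*2))
         (cong₂ binom i/2≡m (q*2/2≡q b x-i+y≡b*2))) ⟨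
  2 ℕ.* evenTerm n k i ∎
  where
  open ≡-Reasoning
  ⌈i/2⌉≡m : ⌈ i /2⌉ ≡ m
  ⌈i/2⌉≡m = trans (cong ⌈_/2⌉ i≡m*2) (⌈m*2/2⌉ m)
  ⌊i/2⌋≡m : ⌊ i /2⌋ ≡ m
  ⌊i/2⌋≡m = trans (cong ⌊_/2⌋ i≡m*2) (⌊m*2/2⌋ m)
  module D = Signed._∣_ (Signed.∣ᵤ⇒∣ {+ 2} {n - k} 2∣n-k)
  a b : ℤ
  -- These are (n - i - k)/2 and (n - i + k)/2, with (n - k)/2 taken from the divisibility
  -- hypothesis.
  a = D.quotient - + m
  b = a + k
  A B : ℕ
  A = binom m a
  B = binom m b
  double : ∀ i A B → i ℕ.* (A ℕ.* B ℕ.+ B ℕ.* A) ≡ 2 ℕ.* (i ℕ.* (A ℕ.* B))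
  double = ℕSolver.solve-∀
  i/2≡m : i ℕ./ 2 ≡ m
  i/2≡m = trans (cong (ℕ._/ 2) i≡m*2) (ℕ.m*n/n≡m m 2)
  +i≡m*2 : + i ≡ + m ℤ.* + 2
  +i≡m*2 = trans (cong +_ i≡m*2) (ℤ.pos-* m 2)
  x-i-y≡a*2 : n - + i - k ≡ a ℤ.* + 2
  x-i-y≡a*2 = begin
    n - + i - k                           ≡⟨ eq₁ n (+ i) k ⟩
    (n - k) - + i                         ≡⟨ cong₂ _-_ D.equality +i≡m*2 ⟩
    D.quotient ℤ.* + 2 - + m ℤ.* + 2      ≡⟨ eq₂ D.quotient (+ m) ⟩
    a ℤ.* + 2                             ∎
    where
    eq₁ : ∀ n i k → n - i - k ≡ (n - k) - i
    eq₁ = solve-∀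
    eq₂ : ∀ q m → q ℤ.* + 2 - m ℤ.* + 2 ≡ (q - m) ℤ.* + 2
    eq₂ = solve-∀
  x-i+y≡b*2 : n - + i + k ≡ b ℤ.* + 2
  x-i+y≡b*2 = begin
    n - + i + k                  ≡⟨ eq₁ n (+ i) k ⟩
    (n - + i - k) + k ℤ.* + 2    ≡⟨ cong (_+ k ℤ.* + 2) x-i-y≡a*2 ⟩
    a ℤ.* + 2 + k ℤ.* + 2        ≡⟨ ℤ.*-distribʳ-+ (+ 2) a k ⟨
    b ℤ.* + 2                    ∎
    where
    eq₁ : ∀ n i k → n - i + k ≡ (n - i - k) + k ℤ.* + 2
    eq₁ = solve-∀
  n≡ : n ≡ + i + a + b
  n≡ = begin
    n                          ≡⟨ eq₁ n (+ i) k ⟩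
    + i + (n - + i - k) + k    ≡⟨ cong (λ z → + i + z + k) x-i-y≡a*2 ⟩
    + i + a ℤ.* + 2 + k        ≡⟨ eq₂ (+ i) a k ⟩
    + i + a + (a + k)          ∎
    where
    eq₁ : ∀ n i k → n ≡ i + (n - i - k) + k
    eq₁ = solve-∀
    eq₂ : ∀ i a k → i + a ℤ.* + 2 + k ≡ i + a + (a + k)
    eq₂ = solve-∀
  count⁺ : length (ending (n , k) (words Sign.+ i)) ≡ A ℕ.* B
  count⁺ = trans
    (words-count-at Sign.+ i a b (even-gap 2∣i) n≡ (eq a k))
    (cong₂ (λ c f → binom c a ℕ.* binom f b) ⌈i/2⌉≡m ⌊i/2⌋≡m)
    where
    eq : ∀ a k → k ≡ + 2 ℤ.* 0ℤ + (a + k - a)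
    eq = solve-∀
  count⁻ : length (ending (n , k) (words Sign.- i)) ≡ B ℕ.* A
  count⁻ = trans
    (words-count-at Sign.- i b a (even-gap 2∣i) (trans n≡ (swap (+ i) a b)) (eq a k))
    (cong₂ (λ c f → binom c b ℕ.* binom f a) ⌈i/2⌉≡m ⌊i/2⌋≡m)
    where
    swap : ∀ i a b → i + a + b ≡ i + b + a
    swap = solve-∀
    eq : ∀ a k → k ≡ ℤ.- (+ 2 ℤ.* 0ℤ + (a - (a + k)))
    eq = solve-∀

-- For i = 2m + 1 the starting direction has m + 1 steps and the other m. The surplus steep height 2
-- shifts the numbers of flat up- and down-steps to d + 1 and s - 1 when starting upwards, and to d
-- - 1 and s + 1 when starting downwards. These are the two products of the term.
oddTerm-count : ∀ n k i → ¬ (+ 2 ∣ n - k) → ¬ (2 ℕ.∣ i) →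
  i ℕ.* length (ending (n , k) (zigzags i)) ≡ oddTerm n k i
oddTerm-count n k i 2∤n-k 2∤i with oddℕ⇒1+m*2 i 2∤i | odd⇒1+q*2 (n - k) 2∤n-k
... | m , refl | q , n-k≡ = cong (i ℕ.*_) (begin
  length (ending (n , k) (words Sign.+ i ++ words Sign.- i))
    ≡⟨ ∣ending∣-++ (n , k) (words Sign.+ i) (words Sign.- i) ⟩
  length (ending (n , k) (words Sign.+ i)) ℕ.+ length (ending (n , k) (words Sign.- i))
    ≡⟨ cong₂ ℕ._+_ count⁺ count⁻ ⟩
  binom (suc m) (d + 1ℤ) ℕ.* binom m (s - 1ℤ) ℕ.+ binom m (d - 1ℤ) ℕ.* binom (suc m) (s + 1ℤ)
    ≡⟨ cong₂ ℕ._+_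
         (cong₂ ℕ._*_ (cong₂ binom [i+1]/2≡1+m (cong (_+ 1ℤ) d≡)) (cong₂ binom [i-1]/2≡m (cong (_- 1ℤ) s≡)))
         (cong₂ ℕ._*_ (cong₂ binom [i-1]/2≡m (cong (_- 1ℤ) d≡)) (cong₂ binom [i+1]/2≡1+m (cong (_+ 1ℤ) s≡))) ⟨
  _ ∎)
  where
  open ≡-Reasoning
  d s : ℤ
  -- `d` is (n - k - i)/2 and `s` is (n + k - i)/2, both exact because n - k and i are odd.
  d = q - + m
  s = d + k
  +i≡ : + i ≡ 1ℤ + + m ℤ.* + 2
  +i≡ = cong ℤ.suc (ℤ.pos-* m 2)
  [i+1]/2≡1+m : (i ℕ.+ 1) ℕ./ 2 ≡ suc m
  [i+1]/2≡1+m = trans (cong (ℕ._/ 2) (ℕ.+-comm i 1)) (ℕ.m*n/n≡m (suc m) 2)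
  [i-1]/2≡m : (i ℕ.∸ 1) ℕ./ 2 ≡ m
  [i-1]/2≡m = ℕ.m*n/n≡m m 2
  x-y-i≡d*2 : n - k - + i ≡ d ℤ.* + 2
  x-y-i≡d*2 = trans (cong₂ _-_ n-k≡ +i≡) (eq q (+ m))
    where
    eq : ∀ q m → (1ℤ + q ℤ.* + 2) - (1ℤ + m ℤ.* + 2) ≡ (q - m) ℤ.* + 2
    eq = solve-∀
  x+y-i≡s*2 : n + k - + i ≡ s ℤ.* + 2
  x+y-i≡s*2 = begin
    n + k - + i                  ≡⟨ eq n (+ i) k ⟩
    (n - k - + i) + k ℤ.* + 2    ≡⟨ cong (_+ k ℤ.* + 2) x-y-i≡d*2 ⟩
    d ℤ.* + 2 + k ℤ.* + 2        ≡⟨ ℤ.*-distribʳ-+ (+ 2) d k ⟨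
    s ℤ.* + 2                    ∎
    where
    eq : ∀ n i k → n + k - i ≡ (n - k - i) + k ℤ.* + 2
    eq = solve-∀
  d≡ : (n - k - + i) ℤ./ + 2 ≡ d
  d≡ = q*2/2≡q d x-y-i≡d*2
  s≡ : (n + k - + i) ℤ./ + 2 ≡ s
  s≡ = q*2/2≡q s x+y-i≡s*2
  n≡ : n ≡ + i + d ℤ.* + 2 + k
  n≡ = trans (eq n (+ i) k) (cong (λ z → + i + z + k) x-y-i≡d*2)
    where
    eq : ∀ n i k → n ≡ i + (n - k - i) + k
    eq = solve-∀
  count⁺ : length (ending (n , k) (words Sign.+ i)) ≡ binom (suc m) (d + 1ℤ) ℕ.* binom m (s - 1ℤ)
  count⁺ = trans
    (words-count-at Sign.+ i (d + 1ℤ) (s - 1ℤ) (odd-gap 2∤i)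
      (trans n≡ (x≡ (+ i) d k)) (y≡ d k))
    (cong₂ (λ c f → binom c (d + 1ℤ) ℕ.* binom f (s - 1ℤ)) (cong suc (⌊m*2/2⌋ m)) (⌈m*2/2⌉ m))
    where
    x≡ : ∀ i d k → i + d ℤ.* + 2 + k ≡ i + (d + 1ℤ) + (d + k - 1ℤ)
    x≡ = solve-∀
    y≡ : ∀ d k → k ≡ + 2 ℤ.* 1ℤ + ((d + k - 1ℤ) - (d + 1ℤ))
    y≡ = solve-∀
  count⁻ : length (ending (n , k) (words Sign.- i)) ≡ binom m (d - 1ℤ) ℕ.* binom (suc m) (s + 1ℤ)
  count⁻ = trans
    (words-count-at Sign.- i (s + 1ℤ) (d - 1ℤ) (odd-gap 2∤i)
      (trans n≡ (x≡ (+ i) d k)) (y≡ d k))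
    -- The down-steps lead here, whereas the term puts the factor for the up-steps first.
    (trans (cong₂ (λ c f → binom c (s + 1ℤ) ℕ.* binom f (d - 1ℤ)) (cong suc (⌊m*2/2⌋ m)) (⌈m*2/2⌉ m))
           (ℕ.*-comm (binom (suc m) (s + 1ℤ)) (binom m (d - 1ℤ))))
    where
    x≡ : ∀ i d k → i + d ℤ.* + 2 + k ≡ i + (d + k + 1ℤ) + (d - 1ℤ)
    x≡ = solve-∀
    y≡ : ∀ d k → k ≡ ℤ.- (+ 2 ℤ.* 1ℤ + ((d - 1ℤ) - (d + k + 1ℤ)))
    y≡ = solve-∀

-- Parity and range of the lengths that occur

-- Here `a` and `b` are natural numbers; their nonnegativity is what bounds the length from above.
zigzag-endpoint : ∀ {n k p} → 𝒵 n k p →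
  ∃[ σ ] ∃[ a ] ∃[ b ] (n , k) ≡ endpoint σ (length p) (+ a) (+ b)
zigzag-endpoint {p = p} (z , end) with zigzags-cases (length p) (zigzags-complete p z)
... | inj₁ p∈ = let a , b , eq = words-endpoint Sign.+ (length p) p∈ in
  Sign.+ , a , b , trans (sym end) eq
... | inj₂ p∈ = let a , b , eq = words-endpoint Sign.- (length p) p∈ in
  Sign.- , a , b , trans (sym end) eq

-- Half of x - y - i at the last point (x , y) of a path with i steps, when g = gap i.
halfExcess : Sign → ℕ → ℕ → ℤ → ℤ
halfExcess Sign.+ a b g = + a - g
halfExcess Sign.- a b g = + b + g

-- Read modulo 2, this compares the parities of n - k and i; a lower bound on `halfExcess` turns it
-- into an upper bound on i.
endpoint-difference : ∀ σ i a b {n k} → (n , k) ≡ endpoint σ i (+ a) (+ b) →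
  n - k ≡ + i + halfExcess σ a b (gap i) ℤ.* + 2
endpoint-difference Sign.+ i a b refl = eq (+ i) (+ a) (+ b) (gap i)
  where
  eq : ∀ i a b g → (i + a + b) - (+ 2 ℤ.* g + (b - a)) ≡ i + (a - g) ℤ.* + 2
  eq = solve-∀
endpoint-difference Sign.- i a b refl = eq (+ i) (+ a) (+ b) (gap i)
  where
  eq : ∀ i a b g → (i + a + b) - ℤ.- (+ 2 ℤ.* g + (b - a)) ≡ i + (b + g) ℤ.* + 2
  eq = solve-∀

even-difference⇔even-length : ∀ {n k p} → 𝒵 n k p →
  (+ 2 ∣ n - k → 2 ℕ.∣ length p) × (2 ℕ.∣ length p → + 2 ∣ n - k)
even-difference⇔even-length {n} {k} {p} z with zigzag-endpoint z
... | σ , a , b , eq rewrite endpoint-difference σ (length p) a b eq =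
    (λ d → Signed.∣⇒∣ᵤ (Signed.∣m+n∣n⇒∣m {m = i} {n = e ℤ.* + 2} (Signed.∣ᵤ⇒∣ {i = i + e ℤ.* + 2} d) 2∣e*2))
  , (λ d → Signed.∣⇒∣ᵤ (Signed.∣m∣n⇒∣m+n (Signed.∣ᵤ⇒∣ {i = i} d) 2∣e*2))
  where
  i e : ℤ
  i = + length p
  e = halfExcess σ a b (gap (length p))
  2∣e*2 : + 2 Signed.∣ e ℤ.* + 2
  2∣e*2 = Signed.∣n⇒∣m*n e Signed.∣-refl

∈-[0⋯] : ∀ {i u} → + i ≤ u → i ∈ [0⋯ u ]
∈-[0⋯] (+≤+ i≤u) = ∈-upTo⁺ (s≤s i≤u)

[0⋯]-unique : ∀ u → Unique [0⋯ u ]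
[0⋯]-unique (+ m)    = Unique.upTo⁺ (suc m)
[0⋯]-unique -[1+ _ ] = []

i≤i+e*2 : ∀ i {e} → 0ℤ ≤ e → + i ≤ + i + e ℤ.* + 2
i≤i+e*2 i {+ e} _ = subst (λ x → + i ≤ + i + x) (ℤ.pos-* e 2) (+≤+ (ℕ.m≤m+n i (e ℕ.* 2)))

-- For even length the half excess is the number of flat up-steps, whichever direction comes first.
even-length≤ : ∀ {n k p} → 𝒵 n k p → 2 ℕ.∣ length p → + length p ≤ n - k
even-length≤ {p = p} z 2∣p =
  let σ , a , b , eq = zigzag-endpoint z in
  subst (+ length p ≤_) (sym (endpoint-difference σ (length p) a b eq))
    (i≤i+e*2 (length p) (nonneg σ a b (even-gap 2∣p)))
  where
  nonneg : ∀ σ a b {g} → g ≡ 0ℤ → 0ℤ ≤ halfExcess σ a b g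
  nonneg Sign.+ a b refl = subst (0ℤ ≤_) (sym (ℤ.+-identityʳ (+ a))) (+≤+ z≤n)
  nonneg Sign.- a b refl = +≤+ z≤n

-- For odd length the half excess can be -1, namely when the path starts upwards and has no flat
-- up-step; this costs the extra 2.
odd-length≤ : ∀ {n k p} → 𝒵 n k p → ¬ (2 ℕ.∣ length p) → + length p ≤ n - k + + 2
odd-length≤ {n} {k} {p} z 2∤p =
  let σ , a , b , eq = zigzag-endpoint z in
  subst (+ length p ≤_) (begin
      + length p + (halfExcess σ a b (gap (length p)) + 1ℤ) ℤ.* + 2
        ≡⟨ shift (+ length p) (halfExcess σ a b (gap (length p))) ⟩
      + length p + halfExcess σ a b (gap (length p)) ℤ.* + 2 + + 2
        ≡⟨ cong (_+ (+ 2)) (endpoint-difference σ (length p) a b eq) ⟨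
      n - k + + 2 ∎)
    (i≤i+e*2 (length p) (nonneg σ a b (odd-gap 2∤p)))
  where
  open ≡-Reasoning
  shift : ∀ i e → i + (e + 1ℤ) ℤ.* + 2 ≡ i + e ℤ.* + 2 + + 2
  shift = solve-∀
  nonneg : ∀ σ a b {g} → g ≡ 1ℤ → 0ℤ ≤ halfExcess σ a b g + 1ℤ
  nonneg Sign.+ zero    b refl = +≤+ z≤n
  nonneg Sign.+ (suc a) b refl = +≤+ z≤n
  nonneg Sign.- a       b refl = +≤+ z≤n

k≤1⇒odd-length≤ : ∀ {n k p} → k ≤ 1ℤ → 𝒵 n k p → ¬ (2 ℕ.∣ length p) → + length p ≤ n - k
k≤1⇒odd-length≤ {n} {k} {p} k≤1 z 2∤p =
  let σ , a , b , eq = zigzag-endpoint z in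
  subst (+ length p ≤_) (sym (endpoint-difference σ (length p) a b eq))
    (i≤i+e*2 (length p) (nonneg σ a b (cong proj₂ eq) (odd-gap 2∤p)))
  where
  nonneg : ∀ σ a b {g} → k ≡ signed σ (+ 2 ℤ.* g + (+ b - + a)) → g ≡ 1ℤ → 0ℤ ≤ halfExcess σ a b g
  -- The exceptional paths, with half excess -1, end at height 2 + b, which contradicts k ≤ 1.
  nonneg Sign.+ zero b k≡ refl =
    case subst (_≤ 1ℤ) (trans k≡ (cong (_+_ (+ 2)) (ℤ.+-identityʳ (+ b)))) k≤1 of
    λ { (+≤+ (s≤s ())) }
  nonneg Sign.+ (suc a) b _ refl = +≤+ z≤n
  nonneg Sign.- a       b _ refl = +≤+ z≤n

-- Rational arithmetic for the expectation

toℚᵘ-/ : ∀ z d → toℚᵘ (z / suc d) ℚᵘ.≃ ℚᵘ.mkℚᵘ z d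
toℚᵘ-/ z d = ℚ.toℚᵘ-fromℚᵘ (ℚᵘ.mkℚᵘ z d)

-- Checked on unnormalised fractions, where equality is an integer identity obtained by
-- cross-multiplication.
ℚ-+-homo : ∀ m n → + (m ℕ.+ n) / 1 ≡ (+ m / 1) ℚ.+ (+ n / 1)
ℚ-+-homo m n = ℚ.toℚᵘ-injective (begin
  toℚᵘ (+ (m ℕ.+ n) / 1)                   ≈⟨ toℚᵘ-/ (+ (m ℕ.+ n)) 0 ⟩
  ℚᵘ.mkℚᵘ (+ (m ℕ.+ n)) 0                  ≈⟨ ℚᵘ.*≡* (eq (+ m) (+ n)) ⟩
  ℚᵘ.mkℚᵘ (+ m) 0 ℚᵘ.+ ℚᵘ.mkℚᵘ (+ n) 0     ≈⟨ ℚᵘ.+-cong (toℚᵘ-/ (+ m) 0) (toℚᵘ-/ (+ n) 0) ⟨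
  toℚᵘ (+ m / 1) ℚᵘ.+ toℚᵘ (+ n / 1)       ≈⟨ ℚ.toℚᵘ-homo-+ (+ m / 1) (+ n / 1) ⟨
  toℚᵘ ((+ m / 1) ℚ.+ (+ n / 1))           ∎)
  where
  open ℚᵘ.≃-Reasoning
  eq : ∀ m n → (m + n) ℤ.* 1ℤ ≡ (m ℤ.* 1ℤ + n ℤ.* 1ℤ) ℤ.* 1ℤ
  eq = solve-∀

double-numerator : ∀ c .{{_ : NonZero c}} s → (+ 1 / c) * (+ (2 ℕ.* s) / 1) ≡ (+ 2 / c) * (+ s / 1)
double-numerator (suc c) s = ℚ.toℚᵘ-injective (begin
  toℚᵘ ((+ 1 / suc c) * (+ (2 ℕ.* s) / 1))           ≈⟨ ℚ.toℚᵘ-homo-* (+ 1 / suc c) (+ (2 ℕ.* s) / 1) ⟩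
  toℚᵘ (+ 1 / suc c) ℚᵘ.* toℚᵘ (+ (2 ℕ.* s) / 1)     ≈⟨ ℚᵘ.*-cong (toℚᵘ-/ (+ 1) c) (toℚᵘ-/ (+ (2 ℕ.* s)) 0) ⟩
  ℚᵘ.mkℚᵘ (+ 1) c ℚᵘ.* ℚᵘ.mkℚᵘ (+ (2 ℕ.* s)) 0       ≈⟨ ℚᵘ.*≡* (cong (ℤ._* + suc (c ℕ.* 1)) (trans (ℤ.*-identityˡ (+ (2 ℕ.* s))) (ℤ.pos-* 2 s))) ⟩
  ℚᵘ.mkℚᵘ (+ 2) c ℚᵘ.* ℚᵘ.mkℚᵘ (+ s) 0               ≈⟨ ℚᵘ.*-cong (toℚᵘ-/ (+ 2) c) (toℚᵘ-/ (+ s) 0) ⟨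
  toℚᵘ (+ 2 / suc c) ℚᵘ.* toℚᵘ (+ s / 1)             ≈⟨ ℚ.toℚᵘ-homo-* (+ 2 / suc c) (+ s / 1) ⟨
  toℚᵘ ((+ 2 / suc c) * (+ s / 1))                   ∎)
  where open ℚᵘ.≃-Reasoning

expectation-sum : ∀ {A : Set} {P : A → Set} (e : Enumeration P) .{{_ : NonZero (card e)}} (X : A → ℕ) →
  expectation e X ≡ (+ 1 / card e) * (+ sum (map X (Enumeration.elements e)) / 1)
expectation-sum e X = go (Enumeration.elements e)
  where
  open ≡-Reasoning
  -- The weight stays at the full cardinality while the induction runs over arbitrary lists.
  c⁻¹ : ℚ
  c⁻¹ = + 1 / card e
  go : ∀ xs → foldr ℚ._+_ 0ℚ (map (λ a → c⁻¹ * (+ X a / 1)) xs) ≡ c⁻¹ * (+ sum (map X xs) / 1)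
  go []       = sym (ℚ.*-zeroʳ c⁻¹)
  go (x ∷ xs) = begin
    c⁻¹ * (+ X x / 1) ℚ.+ foldr ℚ._+_ 0ℚ (map (λ a → c⁻¹ * (+ X a / 1)) xs)
      ≡⟨ cong (c⁻¹ * (+ X x / 1) ℚ.+_) (go xs) ⟩
    c⁻¹ * (+ X x / 1) ℚ.+ c⁻¹ * (+ sum (map X xs) / 1)
      ≡⟨ ℚ.*-distribˡ-+ c⁻¹ (+ X x / 1) (+ sum (map X xs) / 1) ⟨
    c⁻¹ * ((+ X x / 1) ℚ.+ (+ sum (map X xs) / 1))
      ≡⟨ cong (c⁻¹ *_) (ℚ-+-homo (X x) (sum (map X xs))) ⟨
    c⁻¹ * (+ (X x ℕ.+ sum (map X xs)) / 1) ∎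

-- Total number of steps and the expectation

odd? : ∀ i → Dec (¬ (2 ℕ.∣ i))
odd? i = ¬? (2 ℕ.∣? i)

sum-steps-even : ∀ {n k} (e : Enumeration (𝒵 n k)) → + 2 ∣ n - k →
  sum (map steps (Enumeration.elements e)) ≡ 2 ℕ.* Σ-even (n - k) (evenTerm n k)
sum-steps-even {n} {k} e 2∣n-k = begin
  sum (map steps (Enumeration.elements e))
    ≡⟨ sum-steps e evens (Unique.filter⁺ (2 ℕ.∣?_) ([0⋯]-unique (n - k))) covers ⟩
  sum (map (λ i → i ℕ.* length (ending (n , k) (zigzags i))) evens)
    ≡⟨ sum-map-cong-∈ evens (λ {i} i∈ →
         evenTerm-count n k i 2∣n-k (proj₂ (∈-filter⁻ (2 ℕ.∣?_) {xs = [0⋯ n - k ]} i∈))) ⟩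
  sum (map (λ i → 2 ℕ.* evenTerm n k i) evens)
    ≡⟨ sum-map-* 2 (evenTerm n k) evens ⟩
  2 ℕ.* Σ-even (n - k) (evenTerm n k) ∎
  where
  open ≡-Reasoning
  evens : List ℕ
  evens = filter (2 ℕ.∣?_) [0⋯ n - k ]
  covers : ∀ {p} → 𝒵 n k p → length p ∈ evens
  covers z = let 2∣p = proj₁ (even-difference⇔even-length z) 2∣n-k in
    ∈-filter⁺ (2 ℕ.∣?_) (∈-[0⋯] (even-length≤ z 2∣p)) 2∣p

-- The upper limit is a parameter because the theorem needs two of them. Each odd term is an exact
-- weighted count, so any limit that covers all occurring lengths gives the total.
sum-steps-odd : ∀ {n k} (e : Enumeration (𝒵 n k)) u → ¬ (+ 2 ∣ n - k) →
  (∀ {p} → 𝒵 n k p → ¬ (2 ℕ.∣ length p) → + length p ≤ u) →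
  sum (map steps (Enumeration.elements e)) ≡ Σ-odd u (oddTerm n k)
sum-steps-odd {n} {k} e u 2∤n-k bound = begin
  sum (map steps (Enumeration.elements e))
    ≡⟨ sum-steps e odds (Unique.filter⁺ odd? ([0⋯]-unique u)) covers ⟩
  sum (map (λ i → i ℕ.* length (ending (n , k) (zigzags i))) odds)
    ≡⟨ sum-map-cong-∈ odds (λ {i} i∈ →
         oddTerm-count n k i 2∤n-k (proj₂ (∈-filter⁻ odd? {xs = [0⋯ u ]} i∈))) ⟩
  Σ-odd u (oddTerm n k) ∎
  where
  open ≡-Reasoning
  odds : List ℕ
  odds = filter odd? [0⋯ u ]
  covers : ∀ {p} → 𝒵 n k p → length p ∈ odds
  covers z = let 2∤p = 2∤n-k ∘ proj₂ (even-difference⇔even-length z) in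
    ∈-filter⁺ odd? (∈-[0⋯] (bound z 2∤p)) 2∤p

corollary3p5 : (n k : ℤ) .{{_ : NonZero ∣𝒵 n , k ∣}} →
    (+ 2 ∣ n - k →
    𝔼-steps n k ≡ (+ 2 / ∣𝒵 n , k ∣) * (+ Σ-even (n - k) (evenTerm n k) / 1)) ×
    (¬ (+ 2 ∣ n - k) → k ≤ + 1 →
    𝔼-steps n k ≡ (+ 1 / ∣𝒵 n , k ∣) * (+ Σ-odd (n - k) (oddTerm n k) / 1)) ×
    (¬ (+ 2 ∣ n - k) → + 1 < k →
    𝔼-steps n k ≡ (+ 1 / ∣𝒵 n , k ∣) * (+ Σ-odd (n - k + + 2) (oddTerm n k) / 1))
corollary3p5 n k =
    -- The 2 from the two starting directions moves from the sum into the prefactor.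
    (λ 2∣n-k → trans (mean≡ (sum-steps-even e 2∣n-k)) (double-numerator (card e) (Σ-even (n - k) (evenTerm n k))))
  , (λ 2∤n-k k≤1 → mean≡ (sum-steps-odd e (n - k) 2∤n-k (k≤1⇒odd-length≤ k≤1)))
  , (λ 2∤n-k _   → mean≡ (sum-steps-odd e (n - k + + 2) 2∤n-k odd-length≤))
  where
  e : Enumeration (𝒵 n k)
  e = 𝒵-enumeration n k
  mean≡ : ∀ {s} → sum (map steps (Enumeration.elements e)) ≡ s →
    𝔼-steps n k ≡ (+ 1 / ∣𝒵 n , k ∣) * (+ s / 1)
  mean≡ refl = expectation-sum e steps
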